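{- Let $mG$ be a mixed star block graph with $k$ blocks $B_1,\dots,B_k$ of orders $n_1,\dots,n_k$. Then $$\det(mG)=\sum\det(mK_{n_i})\prod_{j=1,\,j\ne i}^k(-1)^{n_j}\left\lfloor\frac{n_j-2}{2}\right\rfloor,$$ where the sum is over all $i\in\{1,\dots,k\}$ such that $n_i$ is odd.
   Context: The directed cycle $dC_n$ has vertices $v_1,\dots,v_n$ and arcs $v_j\to v_{j+1}$ and $v_n\to v_1$. The mixed complete graph $mK_n$ ($n>3$) is obtained from $dC_n$ by adding both arcs between every pair of vertices non-adjacent in the underlying cycle. A mixed star block graph is a strongly connected digraph whose blocks $B_1,\dots,B_k$ are mixed complete graphs $B_i\cong mK_{n_i}$ and which has (at most) one cut-vertex, common to all blocks. $\det$ of a digraph is the determinant of its adjacency matrix ($(p,q)$ entry $1$ if there is an arc from vertex $p$ to vertex $q$, else $0$). -}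

module Defs where

open import Data.Nat as ℕ using (ℕ; zero; suc; _∸_; _<_; _≡ᵇ_)
open import Data.Nat.DivMod using (_/_)
open import Data.Integer as ℤ using (ℤ; +_; -_)
open import Data.Fin using (Fin; toℕ; punchIn; _≟_)
import Data.Fin as Fin
open import Data.Bool using (Bool; true; false; _∨_; _∧_; not; if_then_else_)
open import Data.Product using (Σ; _×_; ∃; ∃-syntax)
open import Function.Bundles using (_⇔_)
open import Function.Definitions using (Injective)
open import Relation.Binary.PropositionalEquality using (_≡_; _≢_)
open import Relation.Nullary.Decidable using (⌊_⌋)

∑ : ∀ k → (Fin k → ℤ) → ℤ
∑ zero    f = + 0
∑ (suc k) f = f Fin.zero ℤ.+ ∑ k (λ i → f (Fin.suc i))

∏ : ∀ k → (Fin k → ℤ) → ℤ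
∏ zero    f = + 1
∏ (suc k) f = f Fin.zero ℤ.* ∏ k (λ i → f (Fin.suc i))

negOnePow : ℕ → ℤ
negOnePow zero    = + 1
negOnePow (suc m) = - negOnePow m

isOdd : ℕ → Bool
isOdd zero    = false
isOdd (suc m) = not (isOdd m)

Matrix : ℕ → Set
Matrix n = Fin n → Fin n → ℤ

det : ∀ n → Matrix n → ℤ
det zero    M = + 1
det (suc n) M =
  ∑ (suc n) (λ j → negOnePow (toℕ j) ℤ.* (M Fin.zero j ℤ.*
     det n (λ r c → M (Fin.suc r) (punchIn j c))))

-- Digraphs on vertex set Fin N (no multiple arcs); arcs given by a
-- Boolean relation: G p q ≡ true iff there is an arc p → q.

Digraph : ℕ → Set
Digraph N = Fin N → Fin N → Bool

adjMatrix : ∀ {N} → Digraph N → Matrix N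
adjMatrix G p q = if G p q then + 1 else + 0

detG : ∀ {N} → Digraph N → ℤ
detG {N} G = det N (adjMatrix G)

-- Directed cycle dC_n on vertices 0,…,n-1 (v_{j+1} ↦ j):
-- arcs j → j+1 and (n-1) → 0.
dC : ∀ n → Digraph n
dC n p q = (toℕ q ≡ᵇ suc (toℕ p)) ∨ ((toℕ p ≡ᵇ n ∸ 1) ∧ (toℕ q ≡ᵇ 0))

mK : ∀ n → Digraph n
mK n p q = dC n p q ∨ (not ⌊ p ≟ q ⌋ ∧ not (dC n p q) ∧ not (dC n q p))

record IsMixedStarBlockGraph {N : ℕ} (G : Digraph N) (k : ℕ) (n : Fin k → ℕ) : Set where
  field
    order>3  : ∀ i → 3 < n i
    c        : Fin N
    emb      : (i : Fin k) → Fin (n i) → Fin N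
    emb-inj  : ∀ i → Injective _≡_ _≡_ (emb i)
    c∈block  : ∀ i → ∃[ a ] emb i a ≡ c
    covers   : ∀ v → ∃[ i ] ∃[ a ] emb i a ≡ v
    disjoint : ∀ i j (a : Fin (n i)) (b : Fin (n j)) → i ≢ j →
               emb i a ≡ emb j b → emb i a ≡ c
    arcs     : ∀ u v → (G u v ≡ true) ⇔
               (∃[ i ] ∃[ a ] ∃[ b ] (emb i a ≡ u × emb i b ≡ v × mK (n i) a b ≡ true))

factor : ℕ → ℤ
factor m = negOnePow m ℤ.* (+ ((m ∸ 2) / 2))

starFormula : ∀ k → (Fin k → ℕ) → ℤ
starFormula k n =
  ∑ k (λ i → if isOdd (n i)
               then det (n i) (adjMatrix (mK (n i))) ℤ.*
                    ∏ k (λ j → if ⌊ j ≟ i ⌋ then + 1 else factor (n j))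
               else + 0)

{-# OPTIONS --safe #-}
-- The determinant is re-read as a function of a list of rows and a list of column labels,
-- defined by the same Laplace expansion; exchanging neighbouring rows and columns shows
-- that it is unchanged when the vertices are listed in another order.  List the vertices
-- as c ∷ b₁ ++ … ++ bₖ with c the cut-vertex.  Since different blocks meet only in c and c
-- has no loop, splitting the row of c gives det (c b₁ … bₖ) = ∑ᵢ det (c bᵢ) ∏_{j≠i} det bⱼ.
-- In mK_n the row of x is 1 - e_y - e_x with y the predecessor of x on the directed cycle.
-- For even n such a row is the alternating sum of the others, so det mK_n = 0; deleting a
-- vertex leaves a path, and splitting off its first row gives a recurrence in the order
-- which is solved by (-1)^n ⌊(n-2)/2⌋.
module Submission where

open import Defs
open import Data.Bool using (if_then_else_; true; false; not)
open import Data.Bool.Properties using (T-≡; T-∨; T-∧; ¬-not; ⇔→≡)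
open import Data.Fin using (Fin; toℕ; punchIn; inject₁; fromℕ; _≟_)
import Data.Fin as Fin using (zero; suc)
open import Data.Fin.Properties using (toℕ-injective; toℕ-inject₁; toℕ-fromℕ)
open import Data.Integer using (ℤ; +_; -[1+_]; -_; _+_; _-_; _*_)
open import Data.Integer.Properties
  using (*-zeroʳ; *-zeroˡ; *-identityˡ; *-comm; neg-involutive; +-identityʳ; +-identityˡ)
open import Data.Integer.Tactic.RingSolver using (solve-∀)
open import Data.List
  using (List; []; _∷_; _++_; [_]; map; tabulate; length; concat; allFin)
open import Data.List.Properties
  using (++-assoc; map-++; length-map; map-tabulate; length-tabulate; ∷-injective)
open import Data.List.Membership.DecPropositional using (_∈?_)
open import Data.List.Membership.Propositional using (_∈_; _∉_)
open import Data.List.Membership.Propositional.Properties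
  using (∈-map⁺; ∈-map⁻; ∈-concat⁻′; ∈-concat⁺′; ∈-tabulate⁻; ∈-tabulate⁺; ∈-allFin; ∈-∃++)
open import Data.List.Membership.Propositional.Properties.WithK using (unique∧set⇒bag)
open import Data.List.Relation.Binary.BagAndSetEquality using (∼bag⇒↭)
open import Data.List.Relation.Binary.Permutation.Propositional
  using (_↭_; refl; prep; swap; trans; ↭⇒↭ₛ)
open import Data.List.Relation.Binary.Permutation.Propositional.Properties
  using (++-comm; ∈-resp-↭; ↭-length)
open import Data.List.Relation.Binary.Permutation.Setoid.Properties using (Unique-resp-↭)
open import Data.List.Relation.Binary.Pointwise using (Pointwise; []; _∷_)
open import Data.List.Relation.Unary.All as All using (All; []; _∷_)
import Data.List.Relation.Unary.All.Properties as All
import Data.List.Relation.Unary.AllPairs as AllPairs using (tail)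
import Data.List.Relation.Unary.AllPairs.Properties as AllPairsₚ
open import Data.List.Relation.Unary.Any using (here; there)
open import Data.List.Relation.Unary.Unique.Propositional using (Unique; []; _∷_)
import Data.List.Relation.Unary.Unique.Propositional.Properties as Unique
open import Data.Nat as ℕ using (ℕ; zero; suc; _<_; _∸_; z≤n; s≤s)
open import Data.Nat.DivMod using (_/_; m/n≡1+[m∸n]/n)
open import Data.Nat.Properties using (≡ᵇ⇒≡; ≡⇒≡ᵇ; suc-injective; m≢1+n+m)
open import Data.Product using (_×_; _,_; proj₁; proj₂; ∃; ∃₂)
open import Data.Sum as Sum using (_⊎_; inj₁; inj₂)
open import Function using (_∘_; id; case_of_)
open import Function.Bundles using (Equivalence; mk⇔)
open import Relation.Binary.Definitions using (DecidableEquality)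
open import Relation.Binary.PropositionalEquality as ≡
  using (_≡_; _≢_; refl; sym; cong; cong₂; subst; module ≡-Reasoning)
open import Relation.Nullary using (¬_; yes; no; does; contradiction)
open import Relation.Nullary.Decidable using (⌊_⌋)

-- Determinants indexed by lists

Row : Set → Set
Row A = A → ℤ

-- Laplace expansion of a row f along the columns cs; K stands for the minors.
expand : ∀ {A} → Row A → List A → (List A → ℤ) → ℤ
expand f []       K = + 0
expand f (c ∷ cs) K = f c * K cs - expand f cs (λ zs → K (c ∷ zs))

-- The value is 0 when the numbers of rows and columns differ; this keeps it
-- alternating in the columns for every list of rows.
listDet : ∀ {A} → List (Row A) → List A → ℤ
listDet []       []      = + 1
listDet []       (_ ∷ _) = + 0
listDet (r ∷ rs) cs      = expand r cs (listDet rs)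

minor : ∀ {A} → (A → Row A) → List A → ℤ
minor M vs = listDet (map M vs) vs

∑-cong : ∀ k {f g : Fin k → ℤ} → (∀ i → f i ≡ g i) → ∑ k f ≡ ∑ k g
∑-cong zero    f≈g = refl
∑-cong (suc k) f≈g = cong₂ _+_ (f≈g Fin.zero) (∑-cong k (f≈g ∘ Fin.suc))

∏-cong : ∀ k {f g : Fin k → ℤ} → (∀ i → f i ≡ g i) → ∏ k f ≡ ∏ k g
∏-cong zero    f≈g = refl
∏-cong (suc k) f≈g = cong₂ _*_ (f≈g Fin.zero) (∏-cong k (f≈g ∘ Fin.suc))

∑-*-distribˡ : ∀ a k f → a * ∑ k f ≡ ∑ k (λ i → a * f i)
∑-*-distribˡ a zero    f = *-zeroʳ a
∑-*-distribˡ a (suc k) f = ≡.trans (identity a (f Fin.zero) _)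
  (cong (_+_ (a * f Fin.zero)) (∑-*-distribˡ a k (f ∘ Fin.suc)))
  where
  identity : ∀ a b c → a * (b + c) ≡ a * b + a * c
  identity = solve-∀

∑-neg : ∀ k f → - ∑ k f ≡ ∑ k (λ i → - f i)
∑-neg zero    f = refl
∑-neg (suc k) f = ≡.trans (identity (f Fin.zero) _) (cong (_+_ (- f Fin.zero)) (∑-neg k (f ∘ Fin.suc)))
  where
  identity : ∀ b c → - (b + c) ≡ - b + - c
  identity = solve-∀

-- Passing over a column negates every later term, so the nested subtractions of `expand` unfold to
-- the signs `negOnePow`.
expand-tabulate : ∀ {A} n (f : Row A) (C : Fin (suc n) → A) K →
  expand f (tabulate C) K ≡
  ∑ (suc n) (λ j → negOnePow (toℕ j) * (f (C j) * K (tabulate (C ∘ punchIn j))))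
expand-tabulate zero    f C K = identity (f (C Fin.zero) * K [])
  where
  identity : ∀ a → a - + 0 ≡ + 1 * a + + 0
  identity = solve-∀
expand-tabulate (suc n) f C K = cong₂ _+_
  (sym (*-identityˡ (f (C Fin.zero) * K (tabulate (C ∘ Fin.suc))))) (begin
  - expand f (tabulate (C ∘ Fin.suc)) (λ zs → K (C Fin.zero ∷ zs))
    ≡⟨ cong -_ (expand-tabulate n f (C ∘ Fin.suc) (λ zs → K (C Fin.zero ∷ zs))) ⟩
  - ∑ (suc n) (λ j → negOnePow (toℕ j) * minorTerm j)
    ≡⟨ ∑-neg (suc n) (λ j → negOnePow (toℕ j) * minorTerm j) ⟩
  ∑ (suc n) (λ j → - (negOnePow (toℕ j) * minorTerm j))
    ≡⟨ ∑-cong (suc n) (λ j → identity (negOnePow (toℕ j)) (minorTerm j)) ⟩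
  ∑ (suc n) (λ j → - negOnePow (toℕ j) * minorTerm j) ∎)
  where
  open ≡-Reasoning
  minorTerm : Fin (suc n) → ℤ
  minorTerm j = f (C (Fin.suc j)) * K (tabulate (C ∘ punchIn (Fin.suc j)))
  identity : ∀ a b → - (a * b) ≡ - a * b
  identity = solve-∀

-- Rows and columns have separate indexing functions because a minor drops row 0 but an arbitrary
-- column `j`.
det≡listDet : ∀ {A} n (R : Fin n → Row A) (C : Fin n → A) →
  det n (λ r c → R r (C c)) ≡ listDet (tabulate R) (tabulate C)
det≡listDet zero    R C = refl
det≡listDet (suc n) R C = ≡.trans
  (∑-cong (suc n) λ j → cong (λ d → negOnePow (toℕ j) * (R Fin.zero (C j) * d))
    (det≡listDet n (R ∘ Fin.suc) (C ∘ punchIn j)))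
  (sym (expand-tabulate n (R Fin.zero) C (listDet (tabulate (R ∘ Fin.suc)))))

-- Congruence and linearity of the expansion

expand-congʳ : ∀ {A} {f : Row A} cs {K L} → (∀ zs → K zs ≡ L zs) → expand f cs K ≡ expand f cs L
expand-congʳ         []       K≈L = refl
expand-congʳ {f = f} (c ∷ cs) K≈L =
  cong₂ (λ a b → f c * a - b) (K≈L cs) (expand-congʳ cs (K≈L ∘ (c ∷_)))

expand-congˡ : ∀ {A} {f g : Row A} {cs} {K} → All (λ c → f c ≡ g c) cs → expand f cs K ≡ expand g cs K
expand-congˡ         []           = refl
expand-congˡ {K = K} (fc≡gc ∷ eq) = cong₂ _-_ (cong (_* K _) fc≡gc) (expand-congˡ eq)

expand-zeroˡ : ∀ {A} {f : Row A} {cs} {K} → All (λ c → f c ≡ + 0) cs → expand f cs K ≡ + 0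
expand-zeroˡ                       []          = refl
expand-zeroˡ {cs = _ ∷ cs} {K = K} (fc≡0 ∷ eq) =
  cong₂ _-_ (≡.trans (cong (_* K cs) fc≡0) (*-zeroˡ (K cs))) (expand-zeroˡ eq)

expand-zeroʳ : ∀ {A} {f : Row A} cs {K} → (∀ zs → K zs ≡ + 0) → expand f cs K ≡ + 0
expand-zeroʳ         []       K≈0 = refl
expand-zeroʳ {f = f} (c ∷ cs) K≈0 =
  cong₂ _-_ (≡.trans (cong (f c *_) (K≈0 cs)) (*-zeroʳ (f c))) (expand-zeroʳ cs (K≈0 ∘ (c ∷_)))

expand-+ˡ : ∀ {A} (f g : Row A) cs K →
  expand (λ c → f c + g c) cs K ≡ expand f cs K + expand g cs K
expand-+ˡ f g []       K = refl
expand-+ˡ f g (c ∷ cs) K = ≡.trans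
  (cong (_-_ ((f c + g c) * K cs)) (expand-+ˡ f g cs _)) (identity (f c) (g c) (K cs) _ _)
  where
  identity : ∀ a b k x y → (a + b) * k - (x + y) ≡ (a * k - x) + (b * k - y)
  identity = solve-∀

expand--ˡ : ∀ {A} (f g : Row A) cs K →
  expand (λ c → f c - g c) cs K ≡ expand f cs K - expand g cs K
expand--ˡ f g []       K = refl
expand--ˡ f g (c ∷ cs) K = ≡.trans
  (cong (_-_ ((f c - g c) * K cs)) (expand--ˡ f g cs _)) (identity (f c) (g c) (K cs) _ _)
  where
  identity : ∀ a b k x y → (a - b) * k - (x - y) ≡ (a * k - x) - (b * k - y)
  identity = solve-∀

-- The continuation has the shape of an inner `expand` after one unfolding, as it occurs when two
-- rows are expanded in succession.
expand-linearʳ : ∀ {A} (f : Row A) cs a K L →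
  expand f cs (λ zs → a * K zs - L zs) ≡ a * expand f cs K - expand f cs L
expand-linearʳ f []       a K L = sym (cong (_- + 0) (*-zeroʳ a))
expand-linearʳ f (c ∷ cs) a K L = ≡.trans
  (cong (_-_ (f c * (a * K cs - L cs))) (expand-linearʳ f cs a _ _))
  (identity (f c) a (K cs) (L cs) _ _)
  where
  identity : ∀ f a k l x y → f * (a * k - l) - (a * x - y) ≡ a * (f * k - x) - (f * l - y)
  identity = solve-∀

expand-*ʳ : ∀ {A} (f : Row A) cs a K → expand f cs (λ zs → a * K zs) ≡ a * expand f cs K
expand-*ʳ f []       a K = sym (*-zeroʳ a)
expand-*ʳ f (c ∷ cs) a K = ≡.trans
  (cong (_-_ (f c * (a * K cs))) (expand-*ʳ f cs a _)) (identity (f c) a (K cs) _)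
  where
  identity : ∀ f a k x → f * (a * k) - a * x ≡ a * (f * k - x)
  identity = solve-∀

expand-negʳ : ∀ {A} (f : Row A) cs K → expand f cs (λ zs → - K zs) ≡ - expand f cs K
expand-negʳ f []       K = refl
expand-negʳ f (c ∷ cs) K = ≡.trans
  (cong (_-_ (f c * - K cs)) (expand-negʳ f cs _)) (identity (f c) (K cs) _)
  where
  identity : ∀ f k x → f * - k - - x ≡ - (f * k - x)
  identity = solve-∀

-- Unfold both sides at the column `c`: the terms in which `f` or `g` takes `c` change places with
-- opposite signs, and those in which neither does are covered by induction with `c` pushed into
-- `K`.
expand-swap-rows : ∀ {A} (f g : Row A) cs K →
  expand f cs (λ zs → expand g zs K) ≡ - expand g cs (λ zs → expand f zs K)
expand-swap-rows f g []       K = refl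
expand-swap-rows f g (c ∷ cs) K = begin
  f c * G - expand f cs (λ zs → g c * K zs - expand g zs K′)
    ≡⟨ cong (_-_ (f c * G)) (expand-linearʳ f cs (g c) K _) ⟩
  f c * G - (g c * F - expand f cs (λ zs → expand g zs K′))
    ≡⟨ cong (λ x → f c * G - (g c * F - x)) (expand-swap-rows f g cs K′) ⟩
  f c * G - (g c * F - - expand g cs (λ zs → expand f zs K′))
    ≡⟨ identity (f c * G) (g c * F) _ ⟩
  - (g c * F - (f c * G - expand g cs (λ zs → expand f zs K′)))
    ≡⟨ cong (λ x → - (g c * F - x)) (expand-linearʳ g cs (f c) K _) ⟨
  - (g c * F - expand g cs (λ zs → f c * K zs - expand f zs K′)) ∎
  where
  open ≡-Reasoning
  K′ = λ zs → K (c ∷ zs)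
  F = expand f cs K
  G = expand g cs K
  identity : ∀ a b x → a - (b - - x) ≡ - (b - (a - x))
  identity = solve-∀

listDet-swap-rows : ∀ {A} (R : List (Row A)) r s rs cs →
  listDet (R ++ r ∷ s ∷ rs) cs ≡ - listDet (R ++ s ∷ r ∷ rs) cs
listDet-swap-rows []      r s rs cs = expand-swap-rows r s cs (listDet rs)
listDet-swap-rows (q ∷ R) r s rs cs = ≡.trans
  (expand-congʳ cs (listDet-swap-rows R r s rs)) (expand-negʳ q cs _)

-- Antisymmetry of `K` is required behind every prefix, since columns passed over are put in front
-- of its argument.
expand-swap-columns : ∀ {A} (f : Row A) C x y cs {K} →
  (∀ C zs → K (C ++ x ∷ y ∷ zs) ≡ - K (C ++ y ∷ x ∷ zs)) →
  expand f (C ++ x ∷ y ∷ cs) K ≡ - expand f (C ++ y ∷ x ∷ cs) K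
expand-swap-columns f []      x y cs {K} anti = begin
  f x * K (y ∷ cs) - (f y * K (x ∷ cs) - expand f cs (λ zs → K (x ∷ y ∷ zs)))
    ≡⟨ cong (λ e → f x * K (y ∷ cs) - (f y * K (x ∷ cs) - e))
         (≡.trans (expand-congʳ cs (anti [])) (expand-negʳ f cs _)) ⟩
  f x * K (y ∷ cs) - (f y * K (x ∷ cs) - - expand f cs (λ zs → K (y ∷ x ∷ zs)))
    ≡⟨ identity (f x * K (y ∷ cs)) (f y * K (x ∷ cs)) _ ⟩
  - (f y * K (x ∷ cs) - (f x * K (y ∷ cs) - expand f cs (λ zs → K (y ∷ x ∷ zs)))) ∎
  where
  open ≡-Reasoning
  identity : ∀ a b x → a - (b - - x) ≡ - (b - (a - x))
  identity = solve-∀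
expand-swap-columns f (c ∷ C) x y cs {K} anti = ≡.trans
  (cong₂ (λ a b → f c * a - b) (anti C cs)
    (expand-swap-columns f C x y cs (λ C′ → anti (c ∷ C′))))
  (identity (f c) _ _)
  where
  identity : ∀ f k x → f * - k - - x ≡ - (f * k - x)
  identity = solve-∀

listDet-swap-columns : ∀ {A} (rs : List (Row A)) C x y cs →
  listDet rs (C ++ x ∷ y ∷ cs) ≡ - listDet rs (C ++ y ∷ x ∷ cs)
listDet-swap-columns []       []      x y cs = refl
listDet-swap-columns []       (_ ∷ _) x y cs = refl
listDet-swap-columns (r ∷ rs) C       x y cs =
  expand-swap-columns r C x y cs (λ C′ → listDet-swap-columns rs C′ x y)

-- Each transposition exchanges two rows and two columns, so its signs cancel. The prefixes `R` and
-- `C` absorb what `prep` and `swap` have passed; `R` need not consist of rows of `M`, which allows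
-- a modified first row later.
listDet-↭ : ∀ {A} (M : A → Row A) R C {xs ys} → xs ↭ ys →
  listDet (R ++ map M xs) (C ++ xs) ≡ listDet (R ++ map M ys) (C ++ ys)
listDet-↭ M R C refl = refl
listDet-↭ M R C {_ ∷ xs} {_ ∷ ys} (prep x p) = begin
  listDet (R ++ M x ∷ map M xs) (C ++ x ∷ xs)
    ≡⟨ cong₂ listDet (++-assoc R [ M x ] _) (++-assoc C [ x ] _) ⟨
  listDet ((R ++ [ M x ]) ++ map M xs) ((C ++ [ x ]) ++ xs)
    ≡⟨ listDet-↭ M (R ++ [ M x ]) (C ++ [ x ]) p ⟩
  listDet ((R ++ [ M x ]) ++ map M ys) ((C ++ [ x ]) ++ ys)
    ≡⟨ cong₂ listDet (++-assoc R [ M x ] _) (++-assoc C [ x ] _) ⟩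
  listDet (R ++ M x ∷ map M ys) (C ++ x ∷ ys) ∎
  where open ≡-Reasoning
listDet-↭ M R C {_ ∷ _ ∷ xs} {_ ∷ _ ∷ ys} (swap x y p) = begin
  listDet (R ++ M x ∷ M y ∷ map M xs) (C ++ x ∷ y ∷ xs)
    ≡⟨ cong₂ listDet (++-assoc R (M x ∷ M y ∷ []) _) (++-assoc C (x ∷ y ∷ []) _) ⟨
  listDet ((R ++ M x ∷ M y ∷ []) ++ map M xs) ((C ++ x ∷ y ∷ []) ++ xs)
    ≡⟨ listDet-↭ M (R ++ M x ∷ M y ∷ []) (C ++ x ∷ y ∷ []) p ⟩
  listDet ((R ++ M x ∷ M y ∷ []) ++ map M ys) ((C ++ x ∷ y ∷ []) ++ ys)
    ≡⟨ cong₂ listDet (++-assoc R (M x ∷ M y ∷ []) _) (++-assoc C (x ∷ y ∷ []) _) ⟩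
  listDet (R ++ M x ∷ M y ∷ map M ys) (C ++ x ∷ y ∷ ys)
    ≡⟨ listDet-swap-rows R (M x) (M y) _ _ ⟩
  - listDet (R ++ M y ∷ M x ∷ map M ys) (C ++ x ∷ y ∷ ys)
    ≡⟨ cong -_ (listDet-swap-columns (R ++ M y ∷ M x ∷ map M ys) C x y ys) ⟩
  - - listDet (R ++ M y ∷ M x ∷ map M ys) (C ++ y ∷ x ∷ ys)
    ≡⟨ neg-involutive _ ⟩
  listDet (R ++ M y ∷ M x ∷ map M ys) (C ++ y ∷ x ∷ ys) ∎
  where open ≡-Reasoning
listDet-↭ M R C (trans p q) = ≡.trans (listDet-↭ M R C p) (listDet-↭ M R C q)

minor-↭ : ∀ {A} (M : A → Row A) {xs ys} → xs ↭ ys → minor M xs ≡ minor M ys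
minor-↭ M = listDet-↭ M [] []

expand-map : ∀ {A B} {φ : A → B} {f : Row B} {g : Row A} cs {K L} →
  (∀ a → f (φ a) ≡ g a) → (∀ zs → K (map φ zs) ≡ L zs) →
  expand f (map φ cs) K ≡ expand g cs L
expand-map []       f≈g K≈L = refl
expand-map (c ∷ cs) f≈g K≈L =
  cong₂ _-_ (cong₂ _*_ (f≈g c) (K≈L cs)) (expand-map cs f≈g (K≈L ∘ (c ∷_)))

listDet-map : ∀ {A B} {φ : A → B} {M : B → Row B} {M′ : A → Row A} →
  (∀ a b → M (φ a) (φ b) ≡ M′ a b) → ∀ xs ys →
  listDet (map M (map φ xs)) (map φ ys) ≡ listDet (map M′ xs) ys
listDet-map eq []       []       = refl
listDet-map eq []       (_ ∷ _)  = refl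
listDet-map eq (x ∷ xs) ys       = expand-map ys (eq x) (listDet-map eq xs)

-- Block triangular matrices and cut-vertices

-- Only columns of `cs` contribute. The length condition keeps the upper left corner square in the
-- induction of `listDet-block`.
expand-block : ∀ {A} (f : Row A) cs {ds K L} e → All (λ d → f d ≡ + 0) ds →
  (∀ zs → suc (length zs) ≡ length cs → K (zs ++ ds) ≡ L zs * e) →
  expand f (cs ++ ds) K ≡ expand f cs L * e
expand-block f []       e f≈0 K≈Le = ≡.trans (expand-zeroˡ f≈0) (sym (*-zeroˡ e))
expand-block f (c ∷ cs) e f≈0 K≈Le = ≡.trans
  (cong₂ (λ a b → f c * a - b) (K≈Le cs refl)
    (expand-block f cs e f≈0 (λ zs eq → K≈Le (c ∷ zs) (cong suc eq))))
  (identity (f c) _ _ e)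
  where
  identity : ∀ f l x e → f * (l * e) - x * e ≡ (f * l - x) * e
  identity = solve-∀

listDet-block : ∀ {A} (rs : List (Row A)) {ss} cs {ds} → length cs ≡ length rs →
  All (λ r → All (λ d → r d ≡ + 0) ds) rs →
  listDet (rs ++ ss) (cs ++ ds) ≡ listDet rs cs * listDet ss ds
listDet-block []       []  eq z         = sym (*-identityˡ _)
listDet-block (r ∷ rs) cs  eq (r≈0 ∷ z) = expand-block r cs _ r≈0
  (λ zs eq′ → listDet-block rs zs (suc-injective (≡.trans eq′ eq)) z)

minor-++ : ∀ {A} (M : A → Row A) xs ys → All (λ x → All (λ y → M x y ≡ + 0) ys) xs →
  minor M (xs ++ ys) ≡ minor M xs * minor M ys
minor-++ M xs ys z = ≡.trans (cong (λ rs → listDet rs (xs ++ ys)) (map-++ M xs ys))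
  (listDet-block (map M xs) xs (sym (length-map M xs)) (All.map⁺ z))

module _ {A : Set} (_≡?_ : DecidableEquality A) (M : A → Row A) where

  -- The row of c is split into its restrictions to c ∷ xs and to ys; after exchanging
  -- xs with ys in the second summand, both summands are block triangular.
  minor-cut-vertex : ∀ c xs ys → M c c ≡ + 0 → All (_∉ ys) xs →
    All (λ x → All (λ y → M x y ≡ + 0) ys) xs → All (λ y → All (λ x → M y x ≡ + 0) xs) ys →
    minor M (c ∷ xs ++ ys) ≡ minor M (c ∷ xs) * minor M ys + minor M xs * minor M (c ∷ ys)
  minor-cut-vertex c xs ys Mcc≡0 xs∉ys xy≈0 yx≈0 = begin
    expand (M c) (c ∷ xs ++ ys) K
      ≡⟨ expand-congˡ {K = K} (All.universal split (c ∷ xs ++ ys)) ⟩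
    expand (λ v → f v + g v) (c ∷ xs ++ ys) K
      ≡⟨ expand-+ˡ f g (c ∷ xs ++ ys) K ⟩
    expand f (c ∷ xs ++ ys) K + expand g (c ∷ xs ++ ys) K
      ≡⟨ cong₂ _+_ f-part g-part ⟩
    minor M (c ∷ xs) * minor M ys + minor M xs * minor M (c ∷ ys) ∎
    where
    open ≡-Reasoning
    K = listDet (map M (xs ++ ys))
    f g : Row A
    f v = if does (_∈?_ _≡?_ v ys) then + 0 else M c v
    g v = if does (_∈?_ _≡?_ v ys) then M c v else + 0
    split : ∀ v → M c v ≡ f v + g v
    split v with does (_∈?_ _≡?_ v ys)
    ... | true  = sym (+-identityˡ (M c v))
    ... | false = sym (+-identityʳ (M c v))
    f-in : ∀ {v} → v ∈ ys → f v ≡ + 0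
    f-in {v} v∈ys with _∈?_ _≡?_ v ys
    ... | yes _   = refl
    ... | no v∉ys = contradiction v∈ys v∉ys
    f-out : ∀ {v} → v ∉ ys → f v ≡ M c v
    f-out {v} v∉ys with _∈?_ _≡?_ v ys
    ... | yes v∈ys = contradiction v∈ys v∉ys
    ... | no _     = refl
    g-in : ∀ {v} → v ∈ ys → g v ≡ M c v
    g-in {v} v∈ys with _∈?_ _≡?_ v ys
    ... | yes _   = refl
    ... | no v∉ys = contradiction v∈ys v∉ys
    g-out : ∀ {v} → v ∉ ys → g v ≡ + 0
    g-out {v} v∉ys with _∈?_ _≡?_ v ys
    ... | yes v∈ys = contradiction v∈ys v∉ys
    ... | no _     = refl
    -- The entry at `c` may be counted in either summand, because it is 0.
    fc≡Mcc : f c ≡ M c c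
    fc≡Mcc with does (_∈?_ _≡?_ c ys)
    ... | true  = sym Mcc≡0
    ... | false = refl
    gc≡Mcc : g c ≡ M c c
    gc≡Mcc with does (_∈?_ _≡?_ c ys)
    ... | true  = refl
    ... | false = sym Mcc≡0
    f-part : expand f (c ∷ xs ++ ys) K ≡ minor M (c ∷ xs) * minor M ys
    f-part = begin
      listDet (f ∷ map M (xs ++ ys)) (c ∷ xs ++ ys)
        ≡⟨ cong (λ rs → listDet (f ∷ rs) (c ∷ xs ++ ys)) (map-++ M xs ys) ⟩
      listDet (f ∷ map M xs ++ map M ys) (c ∷ xs ++ ys)
        ≡⟨ listDet-block (f ∷ map M xs) (c ∷ xs) (cong suc (sym (length-map M xs)))
             (All.tabulate f-in ∷ All.map⁺ xy≈0) ⟩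
      listDet (f ∷ map M xs) (c ∷ xs) * minor M ys
        ≡⟨ cong (_* minor M ys) (expand-congˡ {K = listDet (map M xs)} (fc≡Mcc ∷ All.map f-out xs∉ys)) ⟩
      minor M (c ∷ xs) * minor M ys ∎
    g-part : expand g (c ∷ xs ++ ys) K ≡ minor M xs * minor M (c ∷ ys)
    g-part = begin
      listDet (g ∷ map M (xs ++ ys)) (c ∷ xs ++ ys)
        ≡⟨ listDet-↭ M [ g ] [ c ] (++-comm xs ys) ⟩
      listDet (g ∷ map M (ys ++ xs)) (c ∷ ys ++ xs)
        ≡⟨ cong (λ rs → listDet (g ∷ rs) (c ∷ ys ++ xs)) (map-++ M ys xs) ⟩
      listDet (g ∷ map M ys ++ map M xs) (c ∷ ys ++ xs)
        ≡⟨ listDet-block (g ∷ map M ys) (c ∷ ys) (cong suc (sym (length-map M ys)))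
             (All.map g-out xs∉ys ∷ All.map⁺ yx≈0) ⟩
      listDet (g ∷ map M ys) (c ∷ ys) * minor M xs
        ≡⟨ cong (_* minor M xs) (expand-congˡ {K = listDet (map M ys)} (gc≡Mcc ∷ All.tabulate g-in)) ⟩
      minor M (c ∷ ys) * minor M xs
        ≡⟨ *-comm (minor M (c ∷ ys)) (minor M xs) ⟩
      minor M xs * minor M (c ∷ ys) ∎

-- Several blocks sharing one vertex

cofactorSum : ∀ k (x f : Fin k → ℤ) → ℤ
cofactorSum k x f = ∑ k (λ i → x i * ∏ k (λ j → if ⌊ j ≟ i ⌋ then + 1 else f j))

-- A product rule: it matches the two summands of `minor-cut-vertex` when block 0 is split off.
cofactorSum-suc : ∀ k (x f : Fin (suc k) → ℤ) →
  cofactorSum (suc k) x f ≡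
  x Fin.zero * ∏ k (f ∘ Fin.suc) + f Fin.zero * cofactorSum k (x ∘ Fin.suc) (f ∘ Fin.suc)
cofactorSum-suc k x f = cong₂ _+_
  (cong (x Fin.zero *_) (*-identityˡ (∏ k (f ∘ Fin.suc))))
  (≡.trans (∑-cong k term)
    (sym (∑-*-distribˡ (f Fin.zero) k (λ i → x (Fin.suc i) * rest i))))
  where
  rest : Fin k → ℤ
  rest i = ∏ k (λ j → if ⌊ j ≟ i ⌋ then + 1 else f (Fin.suc j))
  ≟-suc : ∀ (j i : Fin k) → ⌊ Fin.suc j ≟ Fin.suc i ⌋ ≡ ⌊ j ≟ i ⌋
  ≟-suc j i with j ≟ i
  ... | yes _ = refl
  ... | no _  = refl
  identity : ∀ a b c → a * (b * c) ≡ b * (a * c)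
  identity = solve-∀
  term : ∀ i →
    x (Fin.suc i) *
      (f Fin.zero * ∏ k (λ j → if ⌊ Fin.suc j ≟ Fin.suc i ⌋ then + 1 else f (Fin.suc j)))
    ≡ f Fin.zero * (x (Fin.suc i) * rest i)
  term i = ≡.trans
    (cong (λ p → x (Fin.suc i) * (f Fin.zero * p))
      (∏-cong k λ j → cong (if_then + 1 else f (Fin.suc j)) (≟-suc j i)))
    (identity (x (Fin.suc i)) (f Fin.zero) (rest i))

module _ {A : Set} (M : A → Row A) where

  -- One direction of `M` suffices, as `i` and `j` can be exchanged.
  SeparatedBlocks : ∀ k → (Fin k → List A) → Set
  SeparatedBlocks k bs = ∀ {i j} → i ≢ j → ∀ {x y} → x ∈ bs i → y ∈ bs j → x ≢ y × M x y ≡ + 0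

  private
    head-separated : ∀ {k} (bs : Fin (suc k) → List A) → SeparatedBlocks (suc k) bs →
      ∀ {x y} → x ∈ bs Fin.zero → y ∈ concat (tabulate (bs ∘ Fin.suc)) →
      x ≢ y × M x y ≡ + 0 × M y x ≡ + 0
    head-separated bs sep x∈b y∈bs
      with _ , y∈b , b∈bs ← ∈-concat⁻′ (tabulate (bs ∘ Fin.suc)) y∈bs
      with j , refl ← ∈-tabulate⁻ {f = bs ∘ Fin.suc} b∈bs =
      proj₁ (sep {Fin.zero} {Fin.suc j} (λ ()) x∈b y∈b) ,
      proj₂ (sep {Fin.zero} {Fin.suc j} (λ ()) x∈b y∈b) ,
      proj₂ (sep {Fin.suc j} {Fin.zero} (λ ()) y∈b x∈b)

    tail-separated : ∀ {k} (bs : Fin (suc k) → List A) → SeparatedBlocks (suc k) bs →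
      SeparatedBlocks k (bs ∘ Fin.suc)
    tail-separated bs sep i≢j = sep (λ { refl → i≢j refl })

  minor-concat : ∀ k (bs : Fin k → List A) → SeparatedBlocks k bs →
    minor M (concat (tabulate bs)) ≡ ∏ k (λ i → minor M (bs i))
  minor-concat zero    bs sep = refl
  minor-concat (suc k) bs sep = ≡.trans
    (minor-++ M (bs Fin.zero) _
      (All.tabulate λ x∈ → All.tabulate λ y∈ → proj₁ (proj₂ (head-separated bs sep x∈ y∈))))
    (cong (minor M (bs Fin.zero) *_) (minor-concat k (bs ∘ Fin.suc) (tail-separated bs sep)))

  minor-star : DecidableEquality A → ∀ c → M c c ≡ + 0 →
    ∀ k (bs : Fin k → List A) → SeparatedBlocks k bs →
    minor M (c ∷ concat (tabulate bs)) ≡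
    cofactorSum k (λ i → minor M (c ∷ bs i)) (λ i → minor M (bs i))
  -- Without blocks the matrix has the single entry `M c c`, and the sum is empty.
  minor-star _≡?_ c Mcc≡0 zero    bs sep = cong (λ a → a * + 1 - + 0) Mcc≡0
  minor-star _≡?_ c Mcc≡0 (suc k) bs sep = begin
    minor M (c ∷ bs Fin.zero ++ others)
      ≡⟨ minor-cut-vertex _≡?_ M c (bs Fin.zero) others Mcc≡0
           (All.tabulate λ x∈ x∈′ → proj₁ (separated x∈ x∈′) refl)
           (All.tabulate λ x∈ → All.tabulate λ y∈ → proj₁ (proj₂ (separated x∈ y∈)))
           (All.tabulate λ y∈ → All.tabulate λ x∈ → proj₂ (proj₂ (separated x∈ y∈))) ⟩
    minor M (c ∷ bs Fin.zero) * minor M others + minor M (bs Fin.zero) * minor M (c ∷ others)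
      ≡⟨ cong₂ (λ p q → minor M (c ∷ bs Fin.zero) * p + minor M (bs Fin.zero) * q)
           (minor-concat k (bs ∘ Fin.suc) sep′) (minor-star _≡?_ c Mcc≡0 k (bs ∘ Fin.suc) sep′) ⟩
    minor M (c ∷ bs Fin.zero) * ∏ k (λ i → minor M (bs (Fin.suc i))) +
    minor M (bs Fin.zero) *
      cofactorSum k (λ i → minor M (c ∷ bs (Fin.suc i))) (λ i → minor M (bs (Fin.suc i)))
      ≡⟨ cofactorSum-suc k (λ i → minor M (c ∷ bs i)) (λ i → minor M (bs i)) ⟨
    cofactorSum (suc k) (λ i → minor M (c ∷ bs i)) (λ i → minor M (bs i)) ∎
    where
    open ≡-Reasoning
    others = concat (tabulate (bs ∘ Fin.suc))
    separated : ∀ {x y} → x ∈ bs Fin.zero → y ∈ others → x ≢ y × M x y ≡ + 0 × M y x ≡ + 0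
    separated = head-separated bs sep
    sep′ : SeparatedBlocks k (bs ∘ Fin.suc)
    sep′ = tail-separated bs sep

-- Row operations

x≡-x⇒x≡0 : ∀ {x} → x ≡ - x → x ≡ + 0
x≡-x⇒x≡0 {+ zero}   eq = refl
x≡-x⇒x≡0 {+ suc _}  ()
x≡-x⇒x≡0 { -[1+ _ ]} ()

-- Exchanging two equal neighbouring rows shows that the value is its own negative; a more distant
-- copy is reached by exchanges.
listDet-repeated-row : ∀ {A} {r : Row A} {rs} → r ∈ rs → ∀ cs → listDet (r ∷ rs) cs ≡ + 0
listDet-repeated-row {r = r} {_ ∷ rs} (here refl) cs =
  x≡-x⇒x≡0 (listDet-swap-rows [] r r rs cs)
listDet-repeated-row {r = r} {s ∷ rs} (there r∈rs) cs = ≡.trans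
  (listDet-swap-rows [] r s rs cs)
  (cong -_ (expand-zeroʳ cs (listDet-repeated-row r∈rs)))

alternating : ∀ {A} → List (Row A) → Row A
alternating []       z = + 0
alternating (r ∷ rs) z = r z - alternating rs z

-- By linearity in the top row, every term has a repeated row.
listDet-alternating : ∀ {A} {rs ss : List (Row A)} → All (_∈ rs) ss →
  ∀ cs → listDet (alternating ss ∷ rs) cs ≡ + 0
listDet-alternating []           cs = expand-zeroˡ (All.universal (λ _ → refl) cs)
listDet-alternating {rs = rs} {s ∷ ss} (s∈rs ∷ p) cs = ≡.trans
  (expand--ˡ s (alternating ss) cs (listDet rs))
  (cong₂ _-_ (listDet-repeated-row s∈rs cs) (listDet-alternating p cs))

listDet-zero-column : ∀ {A} {rs : List (Row A)} {c} → All (λ r → r c ≡ + 0) rs →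
  ∀ cs → listDet rs (c ∷ cs) ≡ + 0
listDet-zero-column             []           cs = refl
listDet-zero-column {rs = _ ∷ rs} (rc≡0 ∷ z) cs = cong₂ _-_
  (≡.trans (cong (_* listDet rs cs) rc≡0) (*-zeroˡ (listDet rs cs)))
  (expand-zeroʳ cs (listDet-zero-column z))

expand-pivot : ∀ {A} {f : Row A} {c cs} K → f c ≡ + 1 → All (λ d → f d ≡ + 0) cs →
  expand f (c ∷ cs) K ≡ K cs
expand-pivot {cs = cs} K fc≡1 f≈0 = ≡.trans
  (cong₂ _-_ (cong (_* K cs) fc≡1) (expand-zeroˡ f≈0)) (identity (K cs))
  where
  identity : ∀ k → + 1 * k - + 0 ≡ k
  identity = solve-∀

ones : ∀ {A} → Row A
ones _ = + 1

-- Subtracting the row of ones from `1 - g` leaves `- g`, so each row contributes one sign.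
listDet-complement : ∀ {A} {rs gs : List (Row A)} →
  Pointwise (λ r g → ∀ z → r z ≡ + 1 - g z) rs gs →
  ∀ cs → listDet (ones ∷ rs) cs ≡ negOnePow (length gs) * listDet (ones ∷ gs) cs
listDet-complement [] cs = sym (*-identityˡ _)
listDet-complement {rs = r ∷ rs} {g ∷ gs} (r≈1-g ∷ p) cs = begin
  listDet (ones ∷ r ∷ rs) cs
    -- Linearity is at hand in the top row, so `r` is moved there; a second exchange below moves `g`
    -- back and cancels this sign.
    ≡⟨ listDet-swap-rows [] ones r rs cs ⟩
  - listDet (r ∷ ones ∷ rs) cs
    ≡⟨ cong -_ (expand-congˡ (All.universal r≈1-g cs)) ⟩
  - expand (λ z → + 1 - g z) cs (listDet (ones ∷ rs))
    ≡⟨ cong -_ (expand--ˡ ones g cs (listDet (ones ∷ rs))) ⟩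
  - (listDet (ones ∷ ones ∷ rs) cs - listDet (g ∷ ones ∷ rs) cs)
    ≡⟨ cong (λ d → - (d - listDet (g ∷ ones ∷ rs) cs)) (listDet-repeated-row {rs = ones ∷ rs} (here refl) cs) ⟩
  - (+ 0 - expand g cs (listDet (ones ∷ rs)))
    ≡⟨ cong (λ d → - (+ 0 - d))
         (≡.trans (expand-congʳ cs (listDet-complement p)) (expand-*ʳ g cs s _)) ⟩
  - (+ 0 - s * listDet (g ∷ ones ∷ gs) cs)
    ≡⟨ cong (λ d → - (+ 0 - s * d)) (listDet-swap-rows [] g ones gs cs) ⟩
  - (+ 0 - s * - listDet (ones ∷ g ∷ gs) cs)
    ≡⟨ identity s (listDet (ones ∷ g ∷ gs) cs) ⟩
  - s * listDet (ones ∷ g ∷ gs) cs ∎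
  where
  open ≡-Reasoning
  s = negOnePow (length gs)
  identity : ∀ s d → - (+ 0 - s * - d) ≡ - s * d
  identity = solve-∀

-- The alternating sum 1 - 1 + 1 - ... with `m` terms.
parity : ℕ → ℤ
parity m = if isOdd m then + 1 else + 0

parity-suc : ∀ m → parity (suc m) ≡ + 1 - parity m
parity-suc m with isOdd m
... | true  = refl
... | false = refl

negOnePow-isOdd : ∀ m → negOnePow m ≡ (if isOdd m then - (+ 1) else + 1)
negOnePow-isOdd zero    = refl
negOnePow-isOdd (suc m) rewrite negOnePow-isOdd m with isOdd m
... | true  = refl
... | false = refl

negOnePow*parity : ∀ m → negOnePow m * parity (suc m) ≡ parity (suc m)
negOnePow*parity m rewrite negOnePow-isOdd m with isOdd m
... | true  = refl
... | false = refl

-- The determinant of the matrix of order m whose entries are 0 on the diagonal and just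
-- below it and 1 elsewhere.
chainMinor : ℕ → ℤ
chainMinor zero    = + 1
chainMinor (suc m) = parity (suc m) - chainMinor m

-- The induction advances by two, since the floor grows by one at every second step. It starts at
-- order 1: `chainMinor 0` is 1 but `factor 1` is 0.
chainMinor≡factor : ∀ m → chainMinor (suc m) ≡ factor (suc (suc m))
chainMinor≡factor zero          = refl
chainMinor≡factor (suc zero)    = refl
chainMinor≡factor (suc (suc m)) = begin
  parity (3 ℕ.+ m) - (parity (2 ℕ.+ m) - chainMinor (suc m))
    ≡⟨ cong (λ d → parity (3 ℕ.+ m) - (parity (2 ℕ.+ m) - d)) (chainMinor≡factor m) ⟩
  parity (3 ℕ.+ m) - (parity (2 ℕ.+ m) - negOnePow (2 ℕ.+ m) * + (m / 2))
    ≡⟨ regroup (parity (3 ℕ.+ m)) (parity (2 ℕ.+ m)) (negOnePow (2 ℕ.+ m)) (+ (m / 2)) ⟩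
  (parity (3 ℕ.+ m) - parity (2 ℕ.+ m)) + negOnePow (2 ℕ.+ m) * + (m / 2)
    ≡⟨ cong (_+ negOnePow (2 ℕ.+ m) * + (m / 2)) difference ⟩
  negOnePow (2 ℕ.+ m) + negOnePow (2 ℕ.+ m) * + (m / 2)
    ≡⟨ collect (negOnePow (2 ℕ.+ m)) (+ (m / 2)) ⟩
  - - negOnePow (2 ℕ.+ m) * (+ 1 + + (m / 2))
    ≡⟨ cong (λ q → negOnePow (4 ℕ.+ m) * + q) (m/n≡1+[m∸n]/n {2 ℕ.+ m} {2} (s≤s (s≤s z≤n))) ⟨
  negOnePow (4 ℕ.+ m) * + ((2 ℕ.+ m) / 2) ∎
  where
  open ≡-Reasoning
  regroup : ∀ a b s q → a - (b - s * q) ≡ (a - b) + s * q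
  regroup = solve-∀
  collect : ∀ s q → s + s * q ≡ - - s * (+ 1 + q)
  collect = solve-∀
  difference : parity (3 ℕ.+ m) - parity (2 ℕ.+ m) ≡ negOnePow (2 ℕ.+ m)
  difference rewrite negOnePow-isOdd m with isOdd m
  ... | true  = refl
  ... | false = refl

-- Minors along paths and cycles

-- The list omits the start, so every listed vertex has its predecessor on the path.
data Path {A : Set} (Arc : A → A → Set) : A → List A → A → Set where
  []  : ∀ {x} → Path Arc x [] x
  _∷_ : ∀ {x y ys z} → Arc x y → Path Arc y ys z → Path Arc x (y ∷ ys) z

path-++ : ∀ {A} {Arc : A → A → Set} {x xs y z ys w} →
  Path Arc x xs y → Arc y z → Path Arc z ys w → Path Arc x (xs ++ z ∷ ys) w
path-++ []      b q = b ∷ q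
path-++ (a ∷ p) b q = a ∷ path-++ p b q

path-++⁻ : ∀ {A} {Arc : A → A → Set} {x} xs {z ys w} → Path Arc x (xs ++ z ∷ ys) w →
  ∃ λ y → Path Arc x xs y × Arc y z × Path Arc z ys w
path-++⁻ []       (b ∷ q) = _ , [] , b , q
path-++⁻ (x ∷ xs) (a ∷ p) with y , p′ , b , q ← path-++⁻ xs p = y , a ∷ p′ , b , q

module _ {A : Set} (_≡?_ : DecidableEquality A) where

  δ : A → Row A
  δ x z = if does (x ≡? z) then + 1 else + 0

  δ-diagonal : ∀ x → δ x x ≡ + 1
  δ-diagonal x with x ≡? x
  ... | yes _  = refl
  ... | no x≢x = contradiction refl x≢x

  δ-≢ : ∀ {x z} → x ≢ z → δ x z ≡ + 0
  δ-≢ {x} {z} x≢z with x ≡? z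
  ... | yes x≡z = contradiction x≡z x≢z
  ... | no _    = refl

  δ+δ : A → A → Row A
  δ+δ x y z = δ x z + δ y z

  δ+δ-left : ∀ {x y} → x ≢ y → δ+δ x y x ≡ + 1
  δ+δ-left {x} x≢y = cong₂ _+_ (δ-diagonal x) (δ-≢ (x≢y ∘ sym))

  δ+δ-right : ∀ {x y} → x ≢ y → δ+δ x y y ≡ + 1
  δ+δ-right {y = y} x≢y = cong₂ _+_ (δ-≢ x≢y) (δ-diagonal y)

  δ+δ-off : ∀ {x y zs} → All (x ≢_) zs → All (y ≢_) zs → All (λ z → δ+δ x y z ≡ + 0) zs
  δ+δ-off x≢ y≢ = All.zipWith (λ (p , q) → cong₂ _+_ (δ-≢ p) (δ-≢ q)) (x≢ , y≢)

  -- The unsigned incidence matrix of the path, with one row per edge.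
  edgeRows : A → List A → List (Row A)
  edgeRows x []       = []
  edgeRows x (y ∷ ys) = δ+δ x y ∷ edgeRows y ys

  length-edgeRows : ∀ x ys → length (edgeRows x ys) ≡ length ys
  length-edgeRows x []       = refl
  length-edgeRows x (y ∷ ys) = cong suc (length-edgeRows y ys)

  edgeRows-off : ∀ {w} x ys → All (w ≢_) (x ∷ ys) → All (λ r → r w ≡ + 0) (edgeRows x ys)
  edgeRows-off x []       w≢             = []
  edgeRows-off x (y ∷ ys) (w≢x ∷ w≢y ∷ w≢) =
    cong₂ _+_ (δ-≢ (w≢x ∘ sym)) (δ-≢ (w≢y ∘ sym)) ∷ edgeRows-off y ys (w≢y ∷ w≢)

  -- Without the column of the first vertex the incidence matrix is triangular with ones on the
  -- diagonal.
  listDet-edgeRows : ∀ x ys → Unique (x ∷ ys) → listDet (edgeRows x ys) ys ≡ + 1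
  listDet-edgeRows x []       u                          = refl
  listDet-edgeRows x (y ∷ ys) ((x≢y ∷ x≢) ∷ u@(y≢ ∷ _)) = ≡.trans
    (expand-pivot (listDet (edgeRows y ys)) (δ+δ-right x≢y) (δ+δ-off x≢ y≢))
    (listDet-edgeRows y ys u)

  -- Expand along the row of ones. Choosing `x` leaves the triangular determinant 1; the other
  -- choices add up to minus the same determinant for the path starting at `y`. Hence the value `d`
  -- for the shorter path becomes `1 - d`.
  listDet-ones-edgeRows : ∀ x ys → Unique (x ∷ ys) →
    listDet (ones ∷ edgeRows x ys) (x ∷ ys) ≡ parity (suc (length ys))
  listDet-ones-edgeRows x []       u                                = refl
  listDet-ones-edgeRows x (y ∷ ys) u@((x≢y ∷ x≢) ∷ u′@(y≢ ∷ _)) = begin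
    + 1 * listDet (edgeRows x (y ∷ ys)) (y ∷ ys) -
      expand ones (y ∷ ys) (λ zs → listDet (edgeRows x (y ∷ ys)) (x ∷ zs))
      ≡⟨ cong₂ (λ a b → + 1 * a - b) (listDet-edgeRows x (y ∷ ys) u)
           (≡.trans (expand-congʳ {f = ones} (y ∷ ys) first-column) (listDet-ones-edgeRows y ys u′)) ⟩
    + 1 - parity (suc (length ys))
      ≡⟨ parity-suc (suc (length ys)) ⟨
    parity (suc (suc (length ys))) ∎
    where
    open ≡-Reasoning
    E = edgeRows y ys
    identity : ∀ d → + 1 * d - + 0 ≡ d
    identity = solve-∀
    -- Only the first edge meets `x`, so its row must take the column `x`.
    first-column : ∀ zs → listDet (δ+δ x y ∷ E) (x ∷ zs) ≡ listDet E zs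
    first-column zs = ≡.trans
      (cong₂ (λ a b → a * listDet E zs - b) (δ+δ-left x≢y)
        (expand-zeroʳ zs (listDet-zero-column (edgeRows-off y ys (x≢y ∷ x≢)))))
      (identity (listDet E zs))

  module _ {Arc : A → A → Set} (M : A → Row A)
           (M-row : ∀ {x y} → Arc x y → ∀ z → M y z ≡ + 1 - δ+δ x y z) where

    path-rows : ∀ {x ys z} → Path Arc x ys z →
      Pointwise (λ r g → ∀ w → r w ≡ + 1 - g w) (map M ys) (edgeRows x ys)
    path-rows []      = []
    path-rows (a ∷ p) = M-row a ∷ path-rows p

    -- Split the first row as ones minus `δ+δ x y`. The start `x` is not a column, so the second
    -- part has its single 1 at `y` and leaves the minor of the rest. Under the row of ones the
    -- remaining rows may be replaced by incidence rows.
    minor-path : ∀ {x ys z} → Unique (x ∷ ys) → Path Arc x ys z →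
      minor M ys ≡ chainMinor (length ys)
    minor-path u [] = refl
    minor-path {x} {y ∷ ys} ((x≢y ∷ x≢) ∷ u@(y≢ ∷ _)) (a ∷ p) = begin
      expand (M y) (y ∷ ys) K
        ≡⟨ expand-congˡ {K = K} (All.universal (M-row a) (y ∷ ys)) ⟩
      expand (λ z → + 1 - δ+δ x y z) (y ∷ ys) K
        ≡⟨ expand--ˡ ones (δ+δ x y) (y ∷ ys) K ⟩
      listDet (ones ∷ map M ys) (y ∷ ys) - expand (δ+δ x y) (y ∷ ys) K
        ≡⟨ cong₂ _-_ (listDet-complement (path-rows p) (y ∷ ys))
             (expand-pivot K (δ+δ-right x≢y) (δ+δ-off x≢ y≢)) ⟩
      negOnePow (length (edgeRows y ys)) * listDet (ones ∷ edgeRows y ys) (y ∷ ys) - minor M ys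
        ≡⟨ cong₂ _-_ (cong₂ (λ l d → negOnePow l * d) (length-edgeRows y ys)
             (listDet-ones-edgeRows y ys u)) (minor-path u p) ⟩
      negOnePow (length ys) * parity (suc (length ys)) - chainMinor (length ys)
        ≡⟨ cong (_- chainMinor (length ys)) (negOnePow*parity (length ys)) ⟩
      parity (suc (length ys)) - chainMinor (length ys) ∎
      where
      open ≡-Reasoning
      K = listDet (map M ys)

    -- The sum telescopes: each inner vertex occurs in two successive rows with opposite signs, and
    -- only the two ends remain.
    alternating-path : ∀ {x ys z} → Path Arc x ys z → ∀ w →
      alternating (map M ys) w ≡ parity (length ys) - (δ x w - negOnePow (length ys) * δ z w)
    alternating-path {x} [] w = identity (δ x w)
      where
      identity : ∀ d → + 0 ≡ + 0 - (d - + 1 * d)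
      identity = solve-∀
    alternating-path {x} {y ∷ ys} {z} (a ∷ p) w = begin
      M y w - alternating (map M ys) w
        ≡⟨ cong₂ _-_ (M-row a w) (alternating-path p w) ⟩
      (+ 1 - (δ x w + δ y w)) - (parity l - (δ y w - negOnePow l * δ z w))
        ≡⟨ identity (δ x w) (δ y w) (parity l) (negOnePow l) (δ z w) ⟩
      (+ 1 - parity l) - (δ x w - - negOnePow l * δ z w)
        ≡⟨ cong (_- (δ x w - - negOnePow l * δ z w)) (parity-suc l) ⟨
      parity (suc l) - (δ x w - - negOnePow l * δ z w) ∎
      where
      open ≡-Reasoning
      l = length ys
      identity : ∀ x y p s z → (+ 1 - (x + y)) - (p - (y - s * z)) ≡ (+ 1 - p) - (x - - s * z)
      identity = solve-∀

    -- On an even cycle each row is the alternating sum of the other ones.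
    minor-even-cycle : ∀ {x ys z} → Path Arc x ys z → Arc z x → isOdd (length ys) ≡ true →
      minor M (x ∷ ys) ≡ + 0
    minor-even-cycle {x} {ys} {z} p a odd = ≡.trans
      (expand-congˡ {K = listDet (map M ys)} (All.universal row (x ∷ ys)))
      (listDet-alternating {rs = map M ys} (All.tabulate (λ r∈ → r∈)) (x ∷ ys))
      where
      open ≡-Reasoning
      identity : ∀ x z → + 1 - (z + x) ≡ + 1 - (x - - (+ 1) * z)
      identity = solve-∀
      -- For odd length the telescoped sum is 1 minus the indicators of `x` and `z`, which is the
      -- row of `x` by the arc from `z` to `x`.
      row : ∀ w → M x w ≡ alternating (map M ys) w
      row w = begin
        M x w
          ≡⟨ M-row a w ⟩
        + 1 - (δ z w + δ x w)
          ≡⟨ identity (δ x w) (δ z w) ⟩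
        + 1 - (δ x w - - (+ 1) * δ z w)
          ≡⟨ cong₂ (λ p s → p - (δ x w - s * δ z w))
               (cong (if_then + 1 else + 0) odd)
               (≡.trans (negOnePow-isOdd (length ys)) (cong (if_then - (+ 1) else + 1) odd)) ⟨
        parity (length ys) - (δ x w - negOnePow (length ys) * δ z w)
          ≡⟨ alternating-path p w ⟨
        alternating (map M ys) w ∎

-- The mixed complete graph

CycleArc : ∀ n → Fin n → Fin n → Set
CycleArc n p q = dC n p q ≡ true

cycleArc⁻ : ∀ n p q → CycleArc n p q →
  toℕ q ≡ suc (toℕ p) ⊎ (toℕ p ≡ n ∸ 1 × toℕ q ≡ 0)
cycleArc⁻ n p q arc = Sum.map (≡ᵇ⇒≡ _ _)
  (λ t → let t₁ , t₂ = Equivalence.to T-∧ t in ≡ᵇ⇒≡ _ _ t₁ , ≡ᵇ⇒≡ _ _ t₂)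
  (Equivalence.to T-∨ (Equivalence.from T-≡ arc))

cycleArc⁺ : ∀ n p q → toℕ q ≡ suc (toℕ p) ⊎ (toℕ p ≡ n ∸ 1 × toℕ q ≡ 0) → CycleArc n p q
cycleArc⁺ n p q = Equivalence.to T-≡ ∘ Equivalence.from T-∨ ∘
  Sum.map (≡⇒≡ᵇ _ _) (λ (p≡ , q≡) → Equivalence.from T-∧ (≡⇒≡ᵇ _ _ p≡ , ≡⇒≡ᵇ _ _ q≡))

cycleArc-injective : ∀ n p p′ q → CycleArc n p q → CycleArc n p′ q → p ≡ p′
cycleArc-injective n p p′ q arc arc′ with cycleArc⁻ n p q arc | cycleArc⁻ n p′ q arc′
... | inj₁ q≡        | inj₁ q≡′       = toℕ-injective (suc-injective (≡.trans (sym q≡) q≡′))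
... | inj₁ q≡        | inj₂ (_ , q≡0) = contradiction (≡.trans (sym q≡) q≡0) λ ()
... | inj₂ (_ , q≡0) | inj₁ q≡        = contradiction (≡.trans (sym q≡) q≡0) λ ()
... | inj₂ (p≡ , _)  | inj₂ (p≡′ , _) = toℕ-injective (≡.trans p≡ (sym p≡′))

-- Two opposite arcs would force the cycle to have length at most 2.
cycleArc-asymmetric : ∀ n p q → 3 < n → CycleArc n p q → ¬ CycleArc n q p
cycleArc-asymmetric (suc n) p q (s≤s (s≤s 2≤n)) arc arc′
  with cycleArc⁻ (suc n) p q arc | cycleArc⁻ (suc n) q p arc′
... | inj₁ q≡1+p       | inj₁ p≡1+q       = m≢1+n+m (toℕ p) (≡.trans p≡1+q (cong suc q≡1+p))
... | inj₁ q≡1+p       | inj₂ (q≡n , p≡0) =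
  contradiction (≡.trans (sym q≡n) (≡.trans q≡1+p (cong suc p≡0))) λ { refl → case 2≤n of λ () }
... | inj₂ (p≡n , q≡0) | inj₁ p≡1+q       =
  contradiction (≡.trans (sym p≡n) (≡.trans p≡1+q (cong suc q≡0))) λ { refl → case 2≤n of λ () }
... | inj₂ (p≡n , q≡0) | inj₂ (q≡n , p≡0) =
  contradiction (≡.trans (sym p≡n) p≡0) λ ()

cycleArc-irreflexive : ∀ n p → 3 < n → ¬ CycleArc n p p
cycleArc-irreflexive n p 3<n arc = cycleArc-asymmetric n p p 3<n arc arc

mK-irreflexive : ∀ n → 3 < n → ∀ p → mK n p p ≡ false
mK-irreflexive n 3<n p rewrite ¬-not (cycleArc-irreflexive n p 3<n) with p ≟ p
... | yes _  = refl
... | no p≢p = contradiction refl p≢p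

-- Row `q` misses only `q` itself and its predecessor `p`, to which the cycle gives an arc in the
-- other direction only.
mK-row : ∀ n → 3 < n → ∀ p q → CycleArc n p q →
  ∀ z → adjMatrix (mK n) q z ≡ + 1 - δ+δ _≟_ p q z
mK-row n 3<n p q arc z with q ≟ z
... | yes refl
  rewrite ¬-not (cycleArc-irreflexive n q 3<n)
        | δ-≢ _≟_ {p} {q} (λ { refl → cycleArc-irreflexive n q 3<n arc }) = refl
... | no q≢z with p ≟ z
...   | yes refl rewrite ¬-not (cycleArc-asymmetric n p q 3<n arc) | arc = refl
...   | no p≢z
  -- No cycle arc goes from `z` to `q`, as `p` is the only predecessor. So the entry is 1 either by
  -- a cycle arc to `z` or by non-adjacency.
  rewrite ¬-not (λ (arc′ : CycleArc n z q) → p≢z (cycleArc-injective n p z q arc arc′))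
  with dC n q z
...     | true  = refl
...     | false = refl

-- The cycle read from an arbitrary vertex

path-tabulate : ∀ {A} {Arc : A → A → Set} k (f : Fin (suc k) → A) →
  (∀ i → Arc (f (inject₁ i)) (f (Fin.suc i))) →
  Path Arc (f Fin.zero) (tabulate (f ∘ Fin.suc)) (f (fromℕ k))
path-tabulate zero    f arc = []
path-tabulate (suc k) f arc = arc Fin.zero ∷ path-tabulate k (f ∘ Fin.suc) (arc ∘ Fin.suc)

-- The start is arbitrary because the cut-vertex may have any position in its block.
record HamiltonCycle n (x : Fin n) : Set where
  field
    others   : List (Fin n)
    last     : Fin n
    path     : Path (CycleArc n) x others last
    closing  : CycleArc n last x
    vertices : allFin n ↭ x ∷ others

  unique : Unique (x ∷ others)
  unique = Unique-resp-↭ (≡.setoid (Fin n)) (↭⇒↭ₛ vertices) (Unique.allFin⁺ n)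

  length-others : n ≡ suc (length others)
  length-others = ≡.trans (sym (length-tabulate id)) (↭-length vertices)

-- The list of all vertices is cut before `x` and its two pieces are exchanged. The arc back to 0
-- joins them, and the arc at the cut becomes the closing one.
hamiltonCycle : ∀ n x → HamiltonCycle n x
hamiltonCycle (suc m) x = rotate (∈-∃++ (∈-allFin x))
  where
  path₀ : Path (CycleArc (suc m)) Fin.zero (tabulate Fin.suc) (fromℕ m)
  path₀ = path-tabulate m id λ i →
    cycleArc⁺ (suc m) (inject₁ i) (Fin.suc i) (inj₁ (cong suc (sym (toℕ-inject₁ i))))
  closing₀ : CycleArc (suc m) (fromℕ m) Fin.zero
  closing₀ = cycleArc⁺ (suc m) (fromℕ m) Fin.zero (inj₂ (toℕ-fromℕ m , refl))
  rotate : (∃₂ λ us vs → allFin (suc m) ≡ us ++ x ∷ vs) → HamiltonCycle (suc m) x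
  rotate ([] , vs , refl) = record
    { path = path₀ ; closing = closing₀ ; vertices = _↭_.refl }
  rotate (u ∷ us , vs , eq)
    with refl , eq′ ← ∷-injective eq
    with w , p , arc , q ← path-++⁻ us
           (subst (λ l → Path (CycleArc (suc m)) Fin.zero l (fromℕ m)) eq′ path₀) = record
    { path     = path-++ q closing₀ p
    ; closing  = arc
    ; vertices = subst (_↭ x ∷ vs ++ u ∷ us) (sym eq)
        (++-comm (u ∷ us) (x ∷ vs))
    }

det≡minor : ∀ n (M : Matrix n) → det n M ≡ minor M (allFin n)
det≡minor n M = ≡.trans (det≡listDet n M id)
  (cong (λ rs → listDet rs (allFin n)) (sym (map-tabulate id M)))

module _ {n} (3<n : 3 < n) {x} (cycle : HamiltonCycle n x) where
  open HamiltonCycle cycle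

  minor-mK-others : minor (adjMatrix (mK n)) others ≡ factor n
  minor-mK-others = ≡.trans
    (minor-path _≟_ (adjMatrix (mK n)) (mK-row n 3<n _ _) unique path)
    (chain (length others) length-others 3<n)
    where
    -- The minor has order `n` minus 1, hence the shift of index.
    chain : ∀ m {n} → n ≡ suc m → 3 < n → chainMinor m ≡ factor n
    chain zero    refl (s≤s ())
    chain (suc m) refl _ = chainMinor≡factor m

  minor-mK : minor (adjMatrix (mK n)) (x ∷ others) ≡ det n (adjMatrix (mK n))
  minor-mK = ≡.trans (sym (minor-↭ (adjMatrix (mK n)) vertices))
    (sym (det≡minor n (adjMatrix (mK n))))

  minor-mK-even : isOdd n ≡ false → minor (adjMatrix (mK n)) (x ∷ others) ≡ + 0
  minor-mK-even even = minor-even-cycle _≟_ (adjMatrix (mK n)) (mK-row n 3<n _ _) path closing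
    (not-false (≡.trans (cong isOdd (sym length-others)) even))
    where
    not-false : ∀ {b} → not b ≡ false → b ≡ true
    not-false {true} _ = refl

-- Mixed star block graphs

module _ {N} (G : Digraph N) (k : ℕ) (n : Fin k → ℕ) (star : IsMixedStarBlockGraph G k n) where
  open IsMixedStarBlockGraph star

  private
    M : Matrix N
    M = adjMatrix G

    cut : ∀ i → Fin (n i)
    cut i = proj₁ (c∈block i)

    cycle : ∀ i → HamiltonCycle (n i) (cut i)
    cycle i = hamiltonCycle (n i) (cut i)

    others : ∀ i → List (Fin (n i))
    others i = HamiltonCycle.others (cycle i)

    block : Fin k → List (Fin N)
    block i = map (emb i) (others i)

  -- An arc coming from another block would have both ends in two blocks, so both ends would be `c`,
  -- and it would be a loop of a mixed complete graph.
  G-block : ∀ i a b → G (emb i a) (emb i b) ≡ mK (n i) a b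
  G-block i a b = ⇔→≡ (mk⇔ only-block
    (λ arc → Equivalence.from (arcs _ _) (i , a , b , refl , refl , arc)))
    where
    only-block : G (emb i a) (emb i b) ≡ true → mK (n i) a b ≡ true
    only-block arc with Equivalence.to (arcs _ _) arc
    ... | j , a′ , b′ , a≡ , b≡ , arc′ with j ≟ i
    ...   | yes refl
      with refl ← emb-inj i a≡ | refl ← emb-inj i b≡ = arc′
    ...   | no j≢i
      with refl ← emb-inj j (≡.trans (disjoint j i a′ a j≢i a≡) (sym (disjoint j i b′ b j≢i b≡)))
      = contradiction (≡.trans (sym (mK-irreflexive (n j) (order>3 j) a′)) arc′) λ ()

  M-block : ∀ i a b → M (emb i a) (emb i b) ≡ adjMatrix (mK (n i)) a b
  M-block i a b = cong (if_then + 1 else + 0) (G-block i a b)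

  Mcc≡0 : M c c ≡ + 0
  Mcc≡0 with i , a , refl ← covers c =
    ≡.trans (M-block i a a) (cong (if_then + 1 else + 0) (mK-irreflexive (n i) (order>3 i) a))

  c∉block : ∀ i {a} → a ∈ others i → emb i a ≢ c
  c∉block i a∈ a≡c with cut≢ ∷ _ ← HamiltonCycle.unique (cycle i) =
    All.lookup cut≢ a∈ (emb-inj i (≡.trans (proj₂ (c∈block i)) (sym a≡c)))

  -- The block of an arc differs from block `i` or from block `j`. The corresponding end then lies
  -- in two blocks and must be `c`, which `block` leaves out.
  blocks-separated : SeparatedBlocks M k block
  blocks-separated {i} {j} i≢j x∈ y∈
    with a , a∈ , refl ← ∈-map⁻ (emb i) x∈
    with b , b∈ , refl ← ∈-map⁻ (emb j) y∈ =
    (λ a≡b → c∉block i a∈ (disjoint i j a b i≢j a≡b)) ,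
    cong (if_then + 1 else + 0) (¬-not no-arc)
    where
    no-arc : G (emb i a) (emb j b) ≢ true
    no-arc arc with Equivalence.to (arcs _ _) arc
    ... | l , a′ , b′ , a≡ , b≡ , _ with i ≟ l
    ...   | yes refl = c∉block j b∈ (disjoint j i b b′ (i≢j ∘ sym) (sym b≡))
    ...   | no i≢l   = c∉block i a∈ (disjoint i l a a′ i≢l (sym a≡))

  vertices-unique : Unique (c ∷ concat (tabulate block))
  vertices-unique = All.tabulate c≢ ∷ Unique.concat⁺
    (All.tabulate⁺ λ i → Unique.map⁺ (emb-inj i) (AllPairs.tail (HamiltonCycle.unique (cycle i))))
    (AllPairsₚ.tabulate⁺ λ i≢j (v∈ , v∈′) → proj₁ (blocks-separated i≢j v∈ v∈′) refl)
    where
    c≢ : ∀ {v} → v ∈ concat (tabulate block) → c ≢ v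
    c≢ v∈ c≡v
      with _ , v∈b , b∈ ← ∈-concat⁻′ (tabulate block) v∈
      with i , refl ← ∈-tabulate⁻ {f = block} b∈
      with a , a∈ , refl ← ∈-map⁻ (emb i) v∈b = c∉block i a∈ (sym c≡v)

  vertices-complete : ∀ v → v ∈ c ∷ concat (tabulate block)
  vertices-complete v with i , a , refl ← covers v
    with ∈-resp-↭ (HamiltonCycle.vertices (cycle i)) (∈-allFin a)
  ... | here refl = here (proj₂ (c∈block i))
  ... | there a∈  = there (∈-concat⁺′ (∈-map⁺ (emb i) a∈) (∈-tabulate⁺ {f = block} i))

  -- Two lists without repetitions and with the same members are permutations of each other.
  vertices-↭ : allFin N ↭ c ∷ concat (tabulate block)
  vertices-↭ = ∼bag⇒↭ (unique∧set⇒bag (Unique.allFin⁺ N) vertices-unique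
    (mk⇔ (λ _ → vertices-complete _) (λ _ → ∈-allFin _)))

  minor-cut∷block : ∀ i →
    minor M (c ∷ block i) ≡ minor (adjMatrix (mK (n i))) (cut i ∷ others i)
  minor-cut∷block i = ≡.trans
    (cong (λ v → minor M (v ∷ block i)) (sym (proj₂ (c∈block i))))
    (listDet-map {φ = emb i} {M} (M-block i) (cut i ∷ others i) (cut i ∷ others i))

  minor-block : ∀ i → minor M (block i) ≡ factor (n i)
  minor-block i = ≡.trans (listDet-map (M-block i) (others i) (others i))
    (minor-mK-others (order>3 i) (cycle i))

  detG≡starFormula : detG G ≡ starFormula k n
  detG≡starFormula = begin
    det N M
      ≡⟨ det≡minor N M ⟩
    minor M (allFin N)
      ≡⟨ minor-↭ M vertices-↭ ⟩
    minor M (c ∷ concat (tabulate block))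
      ≡⟨ minor-star M _≟_ c Mcc≡0 k block blocks-separated ⟩
    cofactorSum k (λ i → minor M (c ∷ block i)) (λ i → minor M (block i))
      ≡⟨ ∑-cong k term ⟩
    starFormula k n ∎
    where
    open ≡-Reasoning
    cofactor : (Fin k → ℤ) → Fin k → ℤ
    cofactor f i = ∏ k (λ j → if ⌊ j ≟ i ⌋ then + 1 else f j)
    cofactor-block : ∀ i → cofactor (λ j → minor M (block j)) i ≡ cofactor (factor ∘ n) i
    cofactor-block i = ∏-cong k λ j → cong (if ⌊ j ≟ i ⌋ then + 1 else_) (minor-block j)
    term : ∀ i → minor M (c ∷ block i) * cofactor (λ j → minor M (block j)) i ≡
      (if isOdd (n i) then det (n i) (adjMatrix (mK (n i))) * cofactor (factor ∘ n) i else + 0)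
    term i with isOdd (n i) in eq
    ... | true  = cong₂ _*_
      (≡.trans (minor-cut∷block i) (minor-mK (order>3 i) (cycle i))) (cofactor-block i)
    -- A block of even order has determinant 0, so restricting the sum to odd orders loses nothing.
    ... | false = ≡.trans
      (cong (_* cofactor (λ j → minor M (block j)) i)
        (≡.trans (minor-cut∷block i) (minor-mK-even (order>3 i) (cycle i) eq)))
      (*-zeroˡ (cofactor (λ j → minor M (block j)) i))

theorem12 : ∀ {N : ℕ} (G : Digraph N) (k : ℕ) (n : Fin k → ℕ) →
    IsMixedStarBlockGraph G k n →
    detG G ≡ starFormula k n
theorem12 = detG≡starFormula
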